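{- Let $G$ be a tree and let $T'$ be any EPT of $G$ produced by the balanced cut algorithm. Then $\mathrm{EPTsum}(G,T')\le \frac{3}{2}\,\mathrm{EPTsum}(G)$.
   Context: An edge partition tree (EPT) of a tree $G$ is a rooted full binary tree defined inductively: if $G$ has a single vertex, its EPT is a single node (a leaf identified with that vertex); otherwise the root corresponds to an edge $e\in E(G)$ and its two children are roots of EPTs of the two components of $G\setminus e$. Leaves are identified with vertices of $G$ and internal nodes with edges of $G$. The depth of a node is its distance from the root. $\mathrm{EPTsum}(G,T)$ is the sum over all vertices of $G$ of the depth of the corresponding leaf in $T$, and $\mathrm{EPTsum}(G)$ is the minimum of $\mathrm{EPTsum}(G,T)$ over all EPTs $T$ of $G$. An edge $e$ of a tree $H$ is balanced if it minimizes, over all edges of $H$, the number of vertices of the largest component of $H\setminus e$. The balanced cut algorithm builds an EPT of $G$ by choosing a balanced edge $e$ of $G$ as the root and recursively building EPTs of the components of $G\setminus e$ in the same way, making their roots the children of $e$ (ties among balanced edges broken arbitrarily). -}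

module Defs where

open import Data.Nat using (ℕ; zero; suc; _+_; _*_; _≤_; _⊔_)
open import Data.Product using (_×_; _,_; Σ; proj₁; proj₂)
open import Data.Sum using (_⊎_)
open import Data.List using (List; []; _∷_; _++_; length)
open import Data.List.Membership.Propositional using (_∈_)
open import Data.List.Relation.Unary.All using (All)
open import Data.List.Relation.Unary.Unique.Propositional using (Unique)
open import Data.List.Relation.Binary.Permutation.Propositional using (_↭_)
open import Relation.Binary.PropositionalEquality using (_≡_)

-- A finite (multi)graph with vertices labelled by natural numbers.
-- An edge {u,v} is stored as an ordered pair (u , v); it is undirected.
record Graph : Set where
  constructor graph
  field
    V : List ℕ
    E : List (ℕ × ℕ)
open Graph public

Adj : List (ℕ × ℕ) → ℕ → ℕ → Set
Adj E x y = ((x , y) ∈ E) ⊎ ((y , x) ∈ E)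

data Reach (E : List (ℕ × ℕ)) : ℕ → ℕ → Set where
  here : ∀ {x} → Reach E x x
  step : ∀ {x y z} → Adj E x y → Reach E y z → Reach E x z

-- G is a tree: distinct vertices, edges between vertices of G,
-- connected, and |E| = |V| - 1 (in particular V is nonempty).
-- (Connected with |V|-1 edges rules out loops, parallel edges, cycles.)
record IsTree (G : Graph) : Set where
  field
    uniqueV   : Unique (V G)
    endpoints : All (λ e → (proj₁ e ∈ V G) × (proj₂ e ∈ V G)) (E G)
    connected : ∀ {u v} → u ∈ V G → v ∈ V G → Reach (E G) u v
    edgeCount : length (E G) + 1 ≡ length (V G)
open IsTree public

-- G1 and G2 are the two components of G ∖ e: they are trees that
-- partition the vertices of G and the edges of G other than e.
record Split (G : Graph) (e : ℕ × ℕ) (G₁ G₂ : Graph) : Set where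
  field
    vertices : V G ↭ V G₁ ++ V G₂
    edges    : E G ↭ e ∷ (E G₁ ++ E G₂)
    tree₁    : IsTree G₁
    tree₂    : IsTree G₂
open Split public

data BTree : Set where
  leaf : ℕ → BTree
  node : (ℕ × ℕ) → BTree → BTree → BTree

data IsEPT : Graph → BTree → Set where
  leafEPT : ∀ {G v} → V G ≡ v ∷ [] → IsEPT G (leaf v)
  nodeEPT : ∀ {G e l r G₁ G₂} → Split G e G₁ G₂ →
            IsEPT G₁ l → IsEPT G₂ r → IsEPT G (node e l r)

leaves : BTree → ℕ
leaves (leaf _) = 1
leaves (node _ l r) = leaves l + leaves r

-- sum over all leaves of their depth (distance from the root).
-- For an EPT of G this is EPTsum(G,T), leaves being the vertices of G.
EPTsum : BTree → ℕ
EPTsum (leaf _) = 0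
EPTsum (node _ l r) = (EPTsum l + leaves l) + (EPTsum r + leaves r)

maxComp : Graph → Graph → ℕ
maxComp G₁ G₂ = length (V G₁) ⊔ length (V G₂)

Balanced : Graph → (ℕ × ℕ) → Graph → Graph → Set
Balanced H e G₁ G₂ =
  Split H e G₁ G₂ ×
  (∀ f F₁ F₂ → Split H f F₁ F₂ → maxComp G₁ G₂ ≤ maxComp F₁ F₂)

-- T is an EPT of G that can be produced by the balanced cut algorithm
-- (with arbitrary tie-breaking).
data BalancedCutEPT : Graph → BTree → Set where
  leafBC : ∀ {G v} → V G ≡ v ∷ [] → BalancedCutEPT G (leaf v)
  nodeBC : ∀ {G e l r G₁ G₂} → Balanced G e G₁ G₂ →
           BalancedCutEPT G₁ l → BalancedCutEPT G₂ r →
           BalancedCutEPT G (node e l r)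

{-# OPTIONS --safe #-}

-- Give an EPT T the weight w(T) = Σ (p + q + min(p , q)), summed over its internal
-- nodes, where p and q are the numbers of leaves below the two children.  Since
-- min(p , q) ≤ (p + q)/2, we have 2 w(T) ≤ 3 EPTsum(T), so it suffices that
-- EPTsum(T′) ≤ w(T) for every balanced cut EPT T′ and every EPT T of G.  By induction
-- this reduces to w(T) ≥ w(T₁) + w(T₂) + |V(G)|, where T₁ and T₂ are the restrictions
-- of T to the two components of G ∖ e and e is balanced.  Only the nodes of T on the
-- path from the root to e are affected, and balancedness says that the smaller side of
-- every edge has at most min(a , b) vertices, where a and b are the sizes of the sides
-- of e; this keeps the pieces cut off along the path small enough.

module Submission where

open import Defs
open import Data.Nat using (ℕ; suc; _+_; _*_; _≤_; _⊓_; _⊔_; _∸_; z≤n)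
open import Data.Nat.Properties
open import Data.Nat.Tactic.RingSolver using (solve-∀)
open import Data.Product using (_×_; _,_; ∃; ∃₂; proj₁; proj₂)
open import Data.Sum using (_⊎_; inj₁; inj₂)
open import Data.Empty using (⊥-elim)
open import Data.List using (List; []; _∷_; _++_; length; filter)
open import Data.List.Properties using (length-++; filter-++; filter-all; filter-none)
open import Data.List.Membership.Propositional using (_∈_; _∉_)
open import Data.List.Membership.Propositional.Properties
  using (∈-++⁺ˡ; ∈-++⁺ʳ; ∈-++⁻; ∈-filter⁺; ∈-filter⁻)
open import Data.List.Membership.DecPropositional _≟_ using (_∈?_)
open import Data.List.Relation.Unary.Any using (here; there)
open import Data.List.Relation.Unary.All as All using (All; []; _∷_)
import Data.List.Relation.Unary.All.Properties as All
open import Data.List.Relation.Unary.AllPairs using (_∷_)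
open import Data.List.Relation.Unary.Unique.Propositional using (Unique)
import Data.List.Relation.Unary.Unique.Propositional.Properties as Unique
open import Data.List.Relation.Binary.Permutation.Propositional
open import Data.List.Relation.Binary.Permutation.Propositional.Properties
import Data.List.Relation.Binary.Permutation.Setoid.Properties as Permutationₛ
open import Function using (_∘_)
open import Relation.Nullary using (¬_)
open import Relation.Nullary.Decidable using (_×-dec_)
open import Relation.Unary using (Pred; Decidable)
open import Relation.Binary.PropositionalEquality as ≡
  using (_≡_; refl; cong; cong₂; subst; subst₂; setoid; module ≡-Reasoning)

private variable
  G H A₁ A₂ B₁ B₂ C₁ C₂ : Graph
  e f : ℕ × ℕ
  u v w x y : ℕ
  D : List (ℕ × ℕ)

-- Arithmetic of the saved weight.

-- Saving c a b s: the weight drops by (at least) s when a tree is restricted to the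
-- sides, of sizes a and b, of a cut e. The constructors follow the path from the root
-- to the node of e: either it is cut now, or another edge first cuts off p vertices
-- of one side, its smaller side in the whole component having at most c vertices.
data Saving (c : ℕ) : ℕ → ℕ → ℕ → Set where
  cut   : ∀ {a b} → Saving c a b (a + b + a ⊓ b)
  left  : ∀ {a b p s s′} → 1 ≤ a → p ⊓ (a + b) ≤ c → Saving c a b s →
          s + b + p ⊓ (a + b) ≤ s′ + p ⊓ a → Saving c (a + p) b s′
  right : ∀ {a b p s s′} → 1 ≤ b → p ⊓ (b + a) ≤ c → Saving c a b s →
          s + a + p ⊓ (b + a) ≤ s′ + p ⊓ b → Saving c a (b + p) s′

Saving-sym : ∀ {c a b s} → Saving c a b s → Saving c b a s
Saving-sym {c} (cut {a} {b}) =
  subst (Saving c b a) (cong₂ _+_ (+-comm b a) (⊓-comm b a)) cut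
Saving-sym (left  1≤a p≤c sv h) = right 1≤a p≤c (Saving-sym sv) h
Saving-sym (right 1≤b p≤c sv h) = left 1≤b p≤c (Saving-sym sv) h

module _ {a b p s s′ : ℕ} (h : s + b + p ⊓ (a + b) ≤ s′ + p ⊓ a) where

  -- A node whose restriction loses `b` of its leaves saves `b` plus the drop of its min-term from
  -- `p ⊓ (a + b)` to `p ⊓ a`. That drop is never negative, is at least `p - a` if `p ≤ a + b`, and
  -- at least `b` if `a + b ≤ p`: hence the three forms. The `right` case uses them with `a` and `b`
  -- exchanged.
  gain : s + b ≤ s′
  gain = +-cancelʳ-≤ (p ⊓ a) _ _
    (≤-trans (+-monoʳ-≤ (s + b) (⊓-monoʳ-≤ p (m≤m+n a b))) h)

  gain-small : p ≤ a + b → s + b + p ≤ s′ + a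
  gain-small p≤ = subst (λ z → s + b + z ≤ s′ + a) (m≤n⇒m⊓n≡m p≤)
    (≤-trans h (+-monoʳ-≤ s′ (m⊓n≤n p a)))

  gain-large : a + b ≤ p → s + b + b ≤ s′
  gain-large ≤p = +-cancelʳ-≤ a _ _ (begin
    s + b + b + a         ≡⟨ assoc s b a ⟩
    s + b + (a + b)       ≡⟨ cong (s + b +_) (m≥n⇒m⊓n≡n ≤p) ⟨
    s + b + p ⊓ (a + b)   ≤⟨ h ⟩
    s′ + p ⊓ a            ≤⟨ +-monoʳ-≤ s′ (m⊓n≤n p a) ⟩
    s′ + a                ∎)
    where
    open ≤-Reasoning
    assoc : ∀ s b a → s + b + b + a ≡ s + b + (a + b)
    assoc = solve-∀

-- A weaker bound valid for every `c`. It takes over in the `right` case of `Saving-bound`, where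
-- the shorter second side may fall below `c`.
Saving⇒⊓-double : ∀ {c a b s} → Saving c a b s → a ⊓ (b + b) ≤ s
Saving⇒⊓-double (cut {a} {b}) = begin
  a ⊓ (b + b)      ≤⟨ m⊓n≤m a (b + b) ⟩
  a                ≤⟨ m≤m+n a b ⟩
  a + b            ≤⟨ m≤m+n (a + b) (a ⊓ b) ⟩
  a + b + a ⊓ b    ∎
  where open ≤-Reasoning
Saving⇒⊓-double {a = a} (right {b = b} {p = p} {s = s} {s′} _ _ sv h) =
  ≤-trans (m⊓n≤m a _) (≤-trans (m≤n+m a s) (gain {p = p} h))
Saving⇒⊓-double (left {a} {b} {p} {s} {s′} _ _ sv h) with ≤-total b a | ≤-total p (a + b)
... | inj₁ b≤a | _ = begin
  (a + p) ⊓ (b + b)  ≤⟨ m⊓n≤n (a + p) (b + b) ⟩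
  b + b              ≤⟨ +-monoˡ-≤ b (⊓-glb b≤a (m≤m+n b b)) ⟩
  a ⊓ (b + b) + b    ≤⟨ +-monoˡ-≤ b (Saving⇒⊓-double sv) ⟩
  s + b              ≤⟨ gain {p = p} h ⟩
  s′                 ∎
  where open ≤-Reasoning
-- Here `a ⊓ (b + b)` is `a`, so the induction hypothesis reads `a ≤ s`.
... | inj₂ a≤b | inj₁ p≤ = ≤-trans (m⊓n≤m (a + p) (b + b)) (+-cancelʳ-≤ a _ _ (begin
  a + p + a          ≡⟨ +-comm (a + p) a ⟩
  a + (a + p)        ≤⟨ +-mono-≤ (⊓-glb ≤-refl (≤-trans a≤b (m≤m+n b b))) (+-monoˡ-≤ p a≤b) ⟩
  a ⊓ (b + b) + (b + p) ≤⟨ +-monoˡ-≤ (b + p) (Saving⇒⊓-double sv) ⟩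
  s + (b + p)        ≡⟨ +-assoc s b p ⟨
  s + b + p          ≤⟨ gain-small h p≤ ⟩
  s′ + a             ∎))
  where open ≤-Reasoning
... | inj₂ a≤b | inj₂ ≤p = begin
  (a + p) ⊓ (b + b)  ≤⟨ m⊓n≤n (a + p) (b + b) ⟩
  b + b              ≤⟨ +-monoˡ-≤ b (m≤n+m b s) ⟩
  s + b + b          ≤⟨ gain-large h ≤p ⟩
  s′                 ∎
  where open ≤-Reasoning

-- Since `c ≤ b < a + b`, the piece of size at most `c` can only be the one of size `p`.
⊓-small : ∀ {a b c p} → 1 ≤ a → c ≤ b → p ⊓ (a + b) ≤ c → p ≤ b
⊓-small {a} {b} {c} {p} 1≤a c≤b p≤c with ≤-total p (a + b)
... | inj₁ p≤ = subst (_≤ b) (m≤n⇒m⊓n≡m p≤) (≤-trans p≤c c≤b)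
... | inj₂ ≤p with () ← <-irrefl refl (≤-trans (+-monoˡ-≤ b 1≤a)
                   (≤-trans (subst (_≤ c) (m≥n⇒m⊓n≡n ≤p) p≤c) c≤b))

-- A `left` step keeps `b`, so the induction continues, and `c ≤ b` forces `p ≤ b`. A `right` step
-- shortens the second side and may break `c ≤ b`, so there `Saving⇒⊓-double` replaces the induction
-- hypothesis.
Saving-bound : ∀ {c a b s} → c ≤ b → Saving c a b s → a + a ⊓ b ≤ s
Saving-bound c≤b (cut {a} {b}) = +-monoˡ-≤ (a ⊓ b) (m≤m+n a b)
Saving-bound c≤b (left {a} {b} {p} {s} {s′} 1≤a p≤c sv h)
  with p≤b ← ⊓-small 1≤a c≤b p≤c | ≤-total b a
... | inj₁ b≤a = begin
  a + p + (a + p) ⊓ b ≤⟨ +-monoʳ-≤ (a + p) (m⊓n≤n (a + p) b) ⟩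
  a + p + b           ≤⟨ +-monoˡ-≤ b (+-monoʳ-≤ a (⊓-glb (≤-trans p≤b b≤a) p≤b)) ⟩
  a + a ⊓ b + b       ≤⟨ +-monoˡ-≤ b (Saving-bound c≤b sv) ⟩
  s + b               ≤⟨ gain {p = p} h ⟩
  s′                  ∎
  where open ≤-Reasoning
... | inj₂ a≤b = +-cancelʳ-≤ a _ _ (begin
  a + p + (a + p) ⊓ b + a ≤⟨ +-monoˡ-≤ a (+-monoʳ-≤ (a + p) (m⊓n≤n (a + p) b)) ⟩
  a + p + b + a           ≡⟨ shuffle a b p ⟩
  a + a + (b + p)         ≤⟨ +-monoˡ-≤ (b + p) (+-monoʳ-≤ a (⊓-glb ≤-refl a≤b)) ⟩
  a + a ⊓ b + (b + p)     ≤⟨ +-monoˡ-≤ (b + p) (Saving-bound c≤b sv) ⟩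
  s + (b + p)             ≡⟨ +-assoc s b p ⟨
  s + b + p               ≤⟨ gain-small h (≤-trans p≤b (m≤n+m b a)) ⟩
  s′ + a                  ∎)
  where
  open ≤-Reasoning
  shuffle : ∀ a b p → a + p + b + a ≡ a + a + (b + p)
  shuffle = solve-∀
Saving-bound c≤b (right {a} {b} {p} {s} {s′} 1≤b p≤c sv h)
  with ≤-total a (b + b) | ≤-total p (b + a)
... | inj₁ a≤2b | _ = begin
  a + a ⊓ (b + p)   ≤⟨ +-monoʳ-≤ a (m⊓n≤m a (b + p)) ⟩
  a + a             ≤⟨ +-monoˡ-≤ a (⊓-glb ≤-refl a≤2b) ⟩
  a ⊓ (b + b) + a   ≤⟨ +-monoˡ-≤ a (Saving⇒⊓-double sv) ⟩
  s + a             ≤⟨ gain {p = p} h ⟩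
  s′                ∎
  where open ≤-Reasoning
... | inj₂ 2b≤a | inj₁ p≤ = +-cancelʳ-≤ b _ _ (begin
  a + a ⊓ (b + p) + b     ≤⟨ +-monoˡ-≤ b (+-monoʳ-≤ a (m⊓n≤n a (b + p))) ⟩
  a + (b + p) + b         ≡⟨ shuffle a b p ⟩
  b + b + (a + p)         ≤⟨ +-monoˡ-≤ (a + p) (⊓-glb 2b≤a ≤-refl) ⟩
  a ⊓ (b + b) + (a + p)   ≤⟨ +-monoˡ-≤ (a + p) (Saving⇒⊓-double sv) ⟩
  s + (a + p)             ≡⟨ +-assoc s a p ⟨
  s + a + p               ≤⟨ gain-small h p≤ ⟩
  s′ + b                  ∎)
  where
  open ≤-Reasoning
  shuffle : ∀ a b p → a + (b + p) + b ≡ b + b + (a + p)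
  shuffle = solve-∀
... | inj₂ 2b≤a | inj₂ ≤p = begin
  a + a ⊓ (b + p)   ≤⟨ +-monoʳ-≤ a (m⊓n≤m a (b + p)) ⟩
  a + a             ≤⟨ +-monoˡ-≤ a (m≤n+m a s) ⟩
  s + a + a         ≤⟨ gain-large h ≤p ⟩
  s′                ∎
  where open ≤-Reasoning

-- `Saving-bound` is applied with the larger side first; the min-term is then the size of the other
-- side.
Saving-total : ∀ {a b s} → Saving (a ⊓ b) a b s → a + b ≤ s
Saving-total {a} {b} {s} sv with ≤-total b a
... | inj₁ b≤a = subst (λ z → a + z ≤ s) (m≥n⇒m⊓n≡n b≤a) (Saving-bound (m⊓n≤n a b) sv)
... | inj₂ a≤b = subst (_≤ s) (≡.trans (cong (b +_) (m≥n⇒m⊓n≡n a≤b)) (+-comm b a))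
                   (Saving-bound (m⊓n≤m a b) (Saving-sym sv))

-- Balance is defined by the larger side; at a fixed total, the least maximum goes with the greatest
-- minimum.
⊓-⊔-exchange : ∀ {a b c d} → a + b ≡ c + d → a ⊔ b ≤ c ⊔ d → c ⊓ d ≤ a ⊓ b
⊓-⊔-exchange {a} {b} {c} {d} eq le = +-cancelʳ-≤ (c ⊔ d) _ _ (begin
  c ⊓ d + (c ⊔ d)  ≡⟨ m⊓n+m⊔n≡m+n c d ⟩
  c + d          ≡⟨ eq ⟨
  a + b          ≡⟨ m⊓n+m⊔n≡m+n a b ⟨
  a ⊓ b + (a ⊔ b)  ≤⟨ +-monoʳ-≤ (a ⊓ b) le ⟩
  a ⊓ b + (c ⊔ d)  ∎)
  where
  open ≤-Reasoning
  m⊓n+m⊔n≡m+n : ∀ m n → m ⊓ n + (m ⊔ n) ≡ m + n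
  m⊓n+m⊔n≡m+n m n with ≤-total m n
  ... | inj₁ m≤n = cong₂ _+_ (m≤n⇒m⊓n≡m m≤n) (m≤n⇒m⊔n≡n m≤n)
  ... | inj₂ n≤m = ≡.trans (cong₂ _+_ (m≥n⇒m⊓n≡n n≤m) (m≥n⇒m⊔n≡m n≤m)) (+-comm n m)

-- Lists up to permutation.

module _ {a} {X : Set a} where

  ++-cancelˡ-↭ : ∀ (zs : List X) {xs ys} → zs ++ xs ↭ zs ++ ys → xs ↭ ys
  ++-cancelˡ-↭ []       p = p
  ++-cancelˡ-↭ (z ∷ zs) p = ++-cancelˡ-↭ zs (drop-∷ p)

  Unique-++⁻ʳ : ∀ xs {ys : List X} → Unique (xs ++ ys) → Unique ys
  Unique-++⁻ʳ []       u       = u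
  Unique-++⁻ʳ (x ∷ xs) (_ ∷ u) = Unique-++⁻ʳ xs u

  Unique-++⇒∉ : ∀ {xs ys : List X} {z} → Unique (xs ++ ys) → z ∈ xs → z ∉ ys
  Unique-++⇒∉ (p ∷ _) (here refl) z∈ys = All.lookup (All.++⁻ʳ _ p) z∈ys refl
  Unique-++⇒∉ (_ ∷ u) (there z∈)  z∈ys = Unique-++⇒∉ u z∈ z∈ys

  Unique-resp-↭ : ∀ {xs ys : List X} → xs ↭ ys → Unique xs → Unique ys
  Unique-resp-↭ p = Permutationₛ.Unique-resp-↭ (setoid X) (↭⇒↭ₛ p)

  module _ {p} {P : Pred X p} (P? : Decidable P) where

    filter-++-split : ∀ {xs ys zs} → xs ++ ys ↭ zs → All P xs → All (¬_ ∘ P) ys →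
                      xs ↭ filter P? zs
    filter-++-split {xs} {ys} {zs} eq pxs ¬pys = begin
      xs                         ↭⟨ ++-identityʳ xs ⟨
      xs ++ []                   ≡⟨ cong₂ _++_ (filter-all P? pxs) (filter-none P? ¬pys) ⟨
      filter P? xs ++ filter P? ys ≡⟨ filter-++ P? xs ys ⟨
      filter P? (xs ++ ys)       ↭⟨ filter-↭ P? eq ⟩
      filter P? zs               ∎
      where open PermutationReasoning

    -- Two decompositions of one list whose outer blocks `ys` and `ws` are disjoint leave a common
    -- middle block, `filter P? zs`.
    exchange : ∀ {xs ys zs ws} → xs ++ ys ↭ zs ++ ws →
               All P xs → All (¬_ ∘ P) ys → All P ws →
               (xs ↭ filter P? zs ++ ws) × (zs ↭ filter P? zs ++ ys)
    exchange {xs} {ys} {zs} {ws} eq pxs ¬pys pws = first , ++-cancelˡ-↭ ws second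
      where
      open PermutationReasoning
      first : xs ↭ filter P? zs ++ ws
      first = begin
        xs                           ↭⟨ filter-++-split eq pxs ¬pys ⟩
        filter P? (zs ++ ws)         ≡⟨ filter-++ P? zs ws ⟩
        filter P? zs ++ filter P? ws ≡⟨ cong (filter P? zs ++_) (filter-all P? pws) ⟩
        filter P? zs ++ ws           ∎
      second : ws ++ zs ↭ ws ++ filter P? zs ++ ys
      second = begin
        ws ++ zs                     ↭⟨ ++-comm ws zs ⟩
        zs ++ ws                     ↭⟨ eq ⟨
        xs ++ ys                     ↭⟨ ++⁺ʳ ys first ⟩
        (filter P? zs ++ ws) ++ ys   ↭⟨ ++⁺ʳ ys (++-comm (filter P? zs) ws) ⟩
        (ws ++ filter P? zs) ++ ys   ↭⟨ ++-assoc ws _ ys ⟩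
        ws ++ filter P? zs ++ ys     ∎

-- Sizes, edges and walks.

∣_∣ : Graph → ℕ
∣ G ∣ = length (V G)

nonempty : IsTree G → ∃ λ v → v ∈ V G
nonempty {G} t with V G | E G | edgeCount t
... | v ∷ _ | _     | _ = v , here refl
... | []    | []    | ()
... | []    | _ ∷ _ | ()

∣∣-positive : IsTree G → 1 ≤ ∣ G ∣
∣∣-positive {G} t = subst (1 ≤_) (edgeCount t) (m≤n+m 1 (length (E G)))

Within : Graph → ℕ × ℕ → Set
Within G g = (proj₁ g ∈ V G) × (proj₂ g ∈ V G)

Within? : ∀ G → Decidable (Within G)
Within? G g = (proj₁ g ∈? V G) ×-dec (proj₂ g ∈? V G)

Adj-sym : Adj D u v → Adj D v u
Adj-sym (inj₁ p) = inj₂ p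
Adj-sym (inj₂ p) = inj₁ p

Adj-endˡ : IsTree G → Adj (E G) u v → u ∈ V G
Adj-endˡ t (inj₁ p) = proj₁ (All.lookup (endpoints t) p)
Adj-endˡ t (inj₂ p) = proj₂ (All.lookup (endpoints t) p)

Adj-endʳ : IsTree G → Adj (E G) u v → v ∈ V G
Adj-endʳ t = Adj-endˡ t ∘ Adj-sym

Adj-mono : ∀ {D D′} → (∀ {g} → g ∈ D → g ∈ D′) → Adj D u v → Adj D′ u v
Adj-mono inc (inj₁ p) = inj₁ (inc p)
Adj-mono inc (inj₂ p) = inj₂ (inc p)

Reach-mono : ∀ {D D′} → (∀ {g} → g ∈ D → g ∈ D′) → Reach D u v → Reach D′ u v
Reach-mono inc here       = here
Reach-mono inc (step a r) = step (Adj-mono inc a) (Reach-mono inc r)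

Reach-trans : Reach D u v → Reach D v w → Reach D u w
Reach-trans here       q = q
Reach-trans (step a p) q = step a (Reach-trans p q)

Reach-sym : Reach D u v → Reach D v u
Reach-sym here       = here
Reach-sym (step a p) = Reach-trans (Reach-sym p) (step (Adj-sym a) here)

Joins : ℕ × ℕ → ℕ → ℕ → Set
Joins g u v = g ≡ (u , v) ⊎ g ≡ (v , u)

Joins-sym : Joins f u v → Joins f v u
Joins-sym (inj₁ p) = inj₂ p
Joins-sym (inj₂ p) = inj₁ p

Joins-≡ : Joins f u v → Joins f x y → (u ≡ x × v ≡ y) ⊎ (u ≡ y × v ≡ x)
Joins-≡ (inj₁ refl) (inj₁ refl) = inj₁ (refl , refl)
Joins-≡ (inj₁ refl) (inj₂ refl) = inj₂ (refl , refl)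
Joins-≡ (inj₂ refl) (inj₁ refl) = inj₂ (refl , refl)
Joins-≡ (inj₂ refl) (inj₂ refl) = inj₁ (refl , refl)

Joins-Adj : f ∈ D → Joins f u v → Adj D u v
Joins-Adj p (inj₁ refl) = inj₁ p
Joins-Adj p (inj₂ refl) = inj₂ p

Adj⁻ : Adj D u v → ∃ λ g → g ∈ D × Joins g u v
Adj⁻ (inj₁ p) = _ , p , inj₁ refl
Adj⁻ (inj₂ p) = _ , p , inj₂ refl

-- The two sides of a cut.

Split-sym : Split G e A₁ A₂ → Split G e A₂ A₁
Split-sym {A₁ = A₁} {A₂} sp = record
  { vertices = ↭-trans (vertices sp) (++-comm (V A₁) (V A₂))
  ; edges    = ↭-trans (edges sp) (prep _ (++-comm (E A₁) (E A₂)))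
  ; tree₁    = tree₂ sp
  ; tree₂    = tree₁ sp
  }

∣∣-split : Split G e A₁ A₂ → ∣ G ∣ ≡ ∣ A₁ ∣ + ∣ A₂ ∣
∣∣-split {A₁ = A₁} sp = ≡.trans (↭-length (vertices sp)) (length-++ (V A₁))

module _ (sp : Split G e A₁ A₂) where

  ∈-side : v ∈ V G → v ∈ V A₁ ⊎ v ∈ V A₂
  ∈-side = ∈-++⁻ (V A₁) ∘ ∈-resp-↭ (vertices sp)

  V₁⊆ : v ∈ V A₁ → v ∈ V G
  V₁⊆ = ∈-resp-↭ (↭-sym (vertices sp)) ∘ ∈-++⁺ˡ

  E₁⊆ : f ∈ E A₁ → f ∈ E G
  E₁⊆ = ∈-resp-↭ (↭-sym (edges sp)) ∘ there ∘ ∈-++⁺ˡ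

  E-cases : f ∈ E G → f ≡ e ⊎ f ∈ E A₁ ⊎ f ∈ E A₂
  E-cases f∈ with ∈-resp-↭ (edges sp) f∈
  ... | here p  = inj₁ p
  ... | there p = inj₂ (∈-++⁻ (E A₁) p)

  cut∈ : e ∈ E G
  cut∈ = ∈-resp-↭ (↭-sym (edges sp)) (here refl)

  module _ (t : IsTree G) where

    disjoint : v ∈ V A₁ → v ∉ V A₂
    disjoint = Unique-++⇒∉ (Unique-resp-↭ (vertices sp) (uniqueV t))

    -- A walk from one side to the other must leave `A₁` at some point, and only `e` allows that.
    crosses : ∃₂ λ x y → x ∈ V A₁ × y ∈ V A₂ × Joins e x y
    crosses with a , a∈ ← nonempty (tree₁ sp) | b , b∈ ← nonempty (tree₂ sp) =
      go a∈ b∈ (connected t (V₁⊆ a∈)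
                  (∈-resp-↭ (↭-sym (vertices sp)) (∈-++⁺ʳ (V A₁) b∈)))
      where
      go : u ∈ V A₁ → v ∈ V A₂ → Reach (E G) u v →
           ∃₂ λ x y → x ∈ V A₁ × y ∈ V A₂ × Joins e x y
      go u∈ v∈ here = ⊥-elim (disjoint u∈ v∈)
      go u∈ v∈ (step a r) with g , g∈ , j ← Adj⁻ a | E-cases g∈
      ... | inj₂ (inj₁ p) = go (Adj-endʳ (tree₁ sp) (Joins-Adj p j)) v∈ r
      ... | inj₂ (inj₂ p) = ⊥-elim (disjoint u∈ (Adj-endˡ (tree₂ sp) (Joins-Adj p j)))
      ... | inj₁ refl with ∈-side (Adj-endʳ t a)
      ...   | inj₁ w∈ = go w∈ v∈ r
      ...   | inj₂ w∈ = _ , _ , u∈ , w∈ , j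

    cut∉Within : ¬ Within A₁ e
    cut∉Within (p , q) with crosses
    ... | _ , _ , _ , y∈ , inj₁ refl = disjoint q y∈
    ... | _ , _ , _ , y∈ , inj₂ refl = disjoint p y∈

    E₂⇒¬Within : f ∈ E A₂ → ¬ Within A₁ f
    E₂⇒¬Within f∈ (p , _) = disjoint p (proj₁ (All.lookup (endpoints (tree₂ sp)) f∈))

    -- As `e` is the only edge leaving `A₁`, a walk inside `H` that starts in `A₁` never gets out.
    stay : IsTree H → (∀ {g} → g ∈ E H → g ∈ E G) → e ∉ E H →
           u ∈ V H → u ∈ V A₁ → v ∈ V H → v ∈ V A₁
    stay {H} tH inc e∉ u∈H u∈ v∈H = go u∈ (connected tH u∈H v∈H)
      where
      go : u ∈ V A₁ → Reach (E H) u v → v ∈ V A₁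
      go u∈ here = u∈
      go u∈ (step a r) with g , g∈ , j ← Adj⁻ a | E-cases (inc g∈)
      ... | inj₁ refl     = ⊥-elim (e∉ g∈)
      ... | inj₂ (inj₁ p) = go (Adj-endʳ (tree₁ sp) (Joins-Adj p j)) r
      ... | inj₂ (inj₂ p) = ⊥-elim (disjoint u∈ (Adj-endˡ (tree₂ sp) (Joins-Adj p j)))

-- Two cuts and the piece between them.

-- If the cut f lies on side 1 of e and e on side 1 of f, then side 2 of e
-- contains neither cut, hence lies inside side 1 of f.
nested : IsTree G → Split G e A₁ A₂ → Split G f B₁ B₂ → f ∈ E A₁ → e ∈ E B₁ →
         v ∈ V A₂ → v ∈ V B₁
nested t se sf f∈ e∈ v∈
  with x , y , _ , y∈ , j ← crosses se t =
  stay sf t (tree₂ se) (E₁⊆ (Split-sym se))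
    (λ f∈₂ → E₂⇒¬Within se t f∈₂ (All.lookup (endpoints (tree₁ se)) f∈))
    y∈ (Adj-endʳ (tree₁ sf) (Joins-Adj e∈ j)) v∈

module _ (t : IsTree G) (se : Split G e A₁ A₂) (sf : Split G f B₁ B₂)
         (f∈ : f ∈ E A₁) (e∈ : e ∈ E B₁) where

  private
    P? = Within? A₁

  -- The common part of `A₁` and `B₁`. Edges are selected by their endpoints: among the edges of
  -- `B₁`, neither `e` nor an edge of `A₂` has both ends in `A₁`.
  middle : Graph
  middle = graph (filter (_∈? V A₁) (V B₁)) (filter P? (E B₁))

  private
    vs : (V A₁ ↭ V middle ++ V B₂) × (V B₁ ↭ V middle ++ V A₂)
    vs = exchange (_∈? V A₁) (↭-trans (↭-sym (vertices se)) (vertices sf))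
           (All.tabulate (λ p → p))
           (All.tabulate (λ q p → disjoint se t p q))
           (All.tabulate (nested t sf se e∈ f∈))

    es : (E A₁ ↭ E middle ++ f ∷ E B₂) × (E B₁ ↭ E middle ++ e ∷ E A₂)
    es = exchange P?
           -- Each cut edge is moved into the outer block beyond it: `e` joins `E A₂` and `f` joins
           -- `E B₂`.
           (↭-trans (shift e (E A₁) (E A₂)) (↭-trans (↭-sym (edges se))
             (↭-trans (edges sf) (↭-sym (shift f (E B₁) (E B₂))))))
           (endpoints (tree₁ se))
           (cut∉Within se t ∷ All.tabulate (E₂⇒¬Within se t))
           (All.lookup (endpoints (tree₁ se)) f∈ ∷
             All.map (λ (p , q) → nested t sf se e∈ f∈ p , nested t sf se e∈ f∈ q)
                     (endpoints (tree₂ sf)))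

    -- Retracting A₂ onto the endpoint x of e in A₁ maps walks of B₁ to walks of the middle.
    retract : ∃ λ x → ∀ {w v} → v ∈ V A₁ → Reach (E B₁) w v →
              (w ∈ V A₁ → Reach (E middle) w v) × (w ∈ V A₂ → Reach (E middle) x v)
    retract with x , y , x∈ , y∈ , jxy ← crosses se t = x , go
      where
      go : ∀ {w v} → v ∈ V A₁ → Reach (E B₁) w v →
           (w ∈ V A₁ → Reach (E middle) w v) × (w ∈ V A₂ → Reach (E middle) x v)
      go v∈ here = (λ _ → here) , (λ v∈₂ → ⊥-elim (disjoint se t v∈ v∈₂))
      go v∈ (step a r) with g , g∈ , j ← Adj⁻ a | E-cases se (E₁⊆ sf g∈) | go v∈ r
      ... | inj₂ (inj₁ p) | ih₁ , _ =
            (λ _ → step (Joins-Adj (∈-filter⁺ P? g∈ (All.lookup (endpoints (tree₁ se)) p)) j)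
                     (ih₁ (Adj-endʳ (tree₁ se) (Joins-Adj p j)))) ,
            (λ w∈₂ → ⊥-elim (disjoint se t (Adj-endˡ (tree₁ se) (Joins-Adj p j)) w∈₂))
      ... | inj₂ (inj₂ p) | _ , ih₂ =
            (λ w∈₁ → ⊥-elim (disjoint se t w∈₁ (Adj-endˡ (tree₂ se) (Joins-Adj p j)))) ,
            (λ _ → ih₂ (Adj-endʳ (tree₂ se) (Joins-Adj p j)))
      ... | inj₁ refl | ih₁ , ih₂ with Joins-≡ jxy j
      ...   | inj₁ (refl , refl) = (λ _ → ih₂ y∈) , (λ x∈₂ → ⊥-elim (disjoint se t x∈ x∈₂))
      ...   | inj₂ (refl , refl) = (λ y∈₁ → ⊥-elim (disjoint se t y∈₁ y∈)) , (λ _ → ih₁ x∈)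

    middle-tree : IsTree middle
    middle-tree = record
      { uniqueV   = Unique.filter⁺ (_∈? V A₁) (uniqueV (tree₁ sf))
      ; endpoints = All.tabulate λ g∈ → let g∈B , p , q = ∈-filter⁻ P? g∈
                                            p′ , q′ = All.lookup (endpoints (tree₁ sf)) g∈B in
                      ∈-filter⁺ (_∈? V A₁) p′ p , ∈-filter⁺ (_∈? V A₁) q′ q
      ; connected = λ u∈ v∈ → let u∈B , u∈A = ∈-filter⁻ (_∈? V A₁) u∈
                                  v∈B , v∈A = ∈-filter⁻ (_∈? V A₁) v∈ in
                      proj₁ (proj₂ retract v∈A (connected (tree₁ sf) u∈B v∈B)) u∈A
      -- Counted inside `A₁`: removing `f` and the tree `B₂` takes away equally many edges and
      -- vertices.
      ; edgeCount = +-cancelʳ-≡ ∣ B₂ ∣ _ _ (begin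
          length (E middle) + 1 + ∣ B₂ ∣
            ≡⟨ cong (length (E middle) + 1 +_) (edgeCount (tree₂ sf)) ⟨
          length (E middle) + 1 + (length (E B₂) + 1)
            ≡⟨ shuffle (length (E middle)) (length (E B₂)) ⟩
          length (E middle) + suc (length (E B₂)) + 1
            ≡⟨ cong (_+ 1) (length-++ (E middle)) ⟨
          length (E middle ++ f ∷ E B₂) + 1
            ≡⟨ cong (_+ 1) (↭-length (proj₁ es)) ⟨
          length (E A₁) + 1
            ≡⟨ edgeCount (tree₁ se) ⟩
          ∣ A₁ ∣
            ≡⟨ ↭-length (proj₁ vs) ⟩
          length (V middle ++ V B₂)
            ≡⟨ length-++ (V middle) ⟩
          ∣ middle ∣ + ∣ B₂ ∣ ∎)
      }
      where
      open ≡-Reasoning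
      shuffle : ∀ m n → m + 1 + (n + 1) ≡ m + suc n + 1
      shuffle = solve-∀

  middle-splitᵉ : Split B₁ e middle A₂
  middle-splitᵉ = record
    { vertices = proj₂ vs
    ; edges    = ↭-trans (proj₂ es) (shift e (E middle) (E A₂))
    ; tree₁    = middle-tree
    ; tree₂    = tree₂ se
    }

  middle-splitᶠ : Split A₁ f middle B₂
  middle-splitᶠ = record
    { vertices = proj₁ vs
    ; edges    = ↭-trans (proj₁ es) (shift f (E middle) (E B₂))
    ; tree₁    = middle-tree
    ; tree₂    = tree₂ sf
    }

-- From cuts of a component to cuts of the whole tree.

-- A cut of the component `B₁` becomes a cut of `G` once `B₂` is glued back, through `f`, to the
-- side that holds the end `x` of `f`.
attach-side : IsTree G → Split G f B₁ B₂ → Split B₁ e C₁ C₂ →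
              Joins f x y → x ∈ V C₂ → y ∈ V B₂ →
              Split G e C₁ (graph (V C₂ ++ V B₂) (f ∷ (E C₂ ++ E B₂)))
attach-side {G} {f} {B₁} {B₂} {e} {C₁} {C₂} {x} {y} t sf sg j x∈ y∈ = record
  { vertices = vs
  ; edges    = es
  ; tree₁    = tree₁ sg
  ; tree₂    = record
    { uniqueV   = Unique-++⁻ʳ (V C₁) (Unique-resp-↭ vs (uniqueV t))
    ; endpoints = ends j ∷ All.++⁺
        (All.map (λ (p , q) → ∈-++⁺ˡ p , ∈-++⁺ˡ q) (endpoints (tree₂ sg)))
        (All.map (λ (p , q) → ∈-++⁺ʳ (V C₂) p , ∈-++⁺ʳ (V C₂) q) (endpoints (tree₂ sf)))
    ; connected = λ u∈ v∈ → Reach-trans (hub u∈) (Reach-sym (hub v∈))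
    ; edgeCount = begin
        suc (length (E C₂ ++ E B₂)) + 1
          ≡⟨ cong (λ n → suc n + 1) (length-++ (E C₂)) ⟩
        suc (length (E C₂) + length (E B₂)) + 1
          ≡⟨ shuffle (length (E C₂)) (length (E B₂)) ⟩
        length (E C₂) + 1 + (length (E B₂) + 1)
          ≡⟨ cong₂ _+_ (edgeCount (tree₂ sg)) (edgeCount (tree₂ sf)) ⟩
        ∣ C₂ ∣ + ∣ B₂ ∣
          ≡⟨ length-++ (V C₂) ⟨
        length (V C₂ ++ V B₂) ∎
    }
  }
  where
  open ≡-Reasoning
  shuffle : ∀ m n → suc (m + n) + 1 ≡ m + 1 + (n + 1)
  shuffle = solve-∀

  vs : V G ↭ V C₁ ++ (V C₂ ++ V B₂)
  vs = ↭-trans (vertices sf) (↭-trans (++⁺ʳ (V B₂) (vertices sg))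
         (++-assoc (V C₁) (V C₂) (V B₂)))

  es : E G ↭ e ∷ (E C₁ ++ f ∷ (E C₂ ++ E B₂))
  es = ↭-trans (edges sf) (↭-trans (prep f (++⁺ʳ (E B₂) (edges sg)))
         (↭-trans (swap f e (++-assoc (E C₁) (E C₂) (E B₂)))
           (prep e (↭-sym (shift f (E C₁) (E C₂ ++ E B₂))))))

  ends : ∀ {g} → Joins g x y → (proj₁ g ∈ V C₂ ++ V B₂) × (proj₂ g ∈ V C₂ ++ V B₂)
  ends (inj₁ refl) = ∈-++⁺ˡ x∈ , ∈-++⁺ʳ (V C₂) y∈
  ends (inj₂ refl) = ∈-++⁺ʳ (V C₂) y∈ , ∈-++⁺ˡ x∈

  hub : ∀ {u} → u ∈ V C₂ ++ V B₂ → Reach (f ∷ (E C₂ ++ E B₂)) u x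
  hub u∈ with ∈-++⁻ (V C₂) u∈
  ... | inj₁ p = Reach-mono (there ∘ ∈-++⁺ˡ) (connected (tree₂ sg) p x∈)
  ... | inj₂ p = Reach-trans
                   (Reach-mono (there ∘ ∈-++⁺ʳ (E C₂)) (connected (tree₂ sf) p y∈))
                   (step (Joins-Adj (here refl) (Joins-sym j)) here)

-- Balancedness of `e` concerns one tree only. This consequence, with `c` the size of the smaller
-- side of `e`, is inherited by the components met along a path of `T`.
SmallSide≤ : ℕ → Graph → Set
SmallSide≤ c G = ∀ f F₁ F₂ → Split G f F₁ F₂ → ∣ F₁ ∣ ⊓ ∣ F₂ ∣ ≤ c

⊓-∣∣-++ : ∀ F C (vs : List ℕ) → ∣ F ∣ ⊓ ∣ C ∣ ≤ ∣ F ∣ ⊓ length (V C ++ vs)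
⊓-∣∣-++ F C vs = ⊓-monoʳ-≤ ∣ F ∣
  (≤-trans (m≤m+n ∣ C ∣ (length vs)) (≤-reflexive (≡.sym (length-++ (V C)))))

-- Gluing `B₂` back only enlarges one side of the cut, so the smaller side does not shrink on
-- passing from `B₁` to `G`.
SmallSide≤-side : ∀ {c} → IsTree G → SmallSide≤ c G → Split G f B₁ B₂ → SmallSide≤ c B₁
SmallSide≤-side {B₂ = B₂} t small sf g C₁ C₂ sg
  with x , y , x∈ , y∈ , j ← crosses sf t | ∈-side sg x∈
... | inj₂ x∈₂ = ≤-trans (⊓-∣∣-++ C₁ C₂ (V B₂)) (small g _ _ (attach-side t sf sg j x∈₂ y∈))
... | inj₁ x∈₁ = ≤-trans (≤-reflexive (⊓-comm ∣ C₁ ∣ ∣ C₂ ∣))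
    (≤-trans (⊓-∣∣-++ C₂ C₁ (V B₂)) (small g _ _ (attach-side t sf (Split-sym sg) j x∈₁ y∈)))

-- Uniqueness of the components of a cut.

-- A `Split` fixes its components only up to the order of their lists.
_≋_ : Graph → Graph → Set
G ≋ H = (V G ↭ V H) × (E G ↭ E H)

-- By `stay`, each side of the second cut lies in the side of the first with the same end of `e`. So
-- `A₁` and `B₁` are both what membership in `A₁` selects from the same lists.
cut-side-unique : IsTree G → Split G e A₁ A₂ → Split G e B₁ B₂ →
                  Joins e x y → x ∈ V A₁ → x ∈ V B₁ → y ∈ V A₂ → y ∈ V B₂ → A₁ ≋ B₁
cut-side-unique {A₁ = A₁} {A₂} {B₁} {B₂} t sa sb j x∈A x∈B y∈A y∈B =
    ↭-trans (filter-++-split (_∈? V A₁) (↭-trans (↭-sym (vertices sa)) (vertices sb))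
              (All.tabulate (λ p → p)) (All.tabulate λ q p → disjoint sa t p q))
            (↭-sym (filter-++-split (_∈? V A₁) ↭-refl
              (All.tabulate B₁⊆A₁) (All.tabulate λ q p → disjoint sa t p (B₂⊆A₂ q))))
  , ↭-trans (filter-++-split (Within? A₁) (drop-∷ (↭-trans (↭-sym (edges sa)) (edges sb)))
              (endpoints (tree₁ sa)) (All.tabulate (E₂⇒¬Within sa t)))
            (↭-sym (filter-++-split (Within? A₁) ↭-refl
              (All.map (λ (p , q) → B₁⊆A₁ p , B₁⊆A₁ q) (endpoints (tree₁ sb)))
              (All.map (λ (p , _) (q , _) → disjoint sa t q (B₂⊆A₂ p)) (endpoints (tree₂ sb)))))
  where
  B₁⊆A₁ : ∀ {v} → v ∈ V B₁ → v ∈ V A₁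
  B₁⊆A₁ = stay sa t (tree₁ sb) (E₁⊆ sb)
            (λ e∈ → cut∉Within sb t (All.lookup (endpoints (tree₁ sb)) e∈)) x∈B x∈A
  B₂⊆A₂ : ∀ {v} → v ∈ V B₂ → v ∈ V A₂
  B₂⊆A₂ = stay (Split-sym sa) t (tree₂ sb) (E₁⊆ (Split-sym sb))
            (λ e∈ → cut∉Within (Split-sym sb) t (All.lookup (endpoints (tree₂ sb)) e∈)) y∈B y∈A

cut-unique : IsTree G → Split G e A₁ A₂ → Split G e B₁ B₂ →
             (A₁ ≋ B₁ × A₂ ≋ B₂) ⊎ (A₁ ≋ B₂ × A₂ ≋ B₁)
cut-unique t sa sb
  with x , y , x∈ , y∈ , j ← crosses sa t | x′ , y′ , x′∈ , y′∈ , j′ ← crosses sb t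
  with Joins-≡ j j′
... | inj₁ (refl , refl) = inj₁
        ( cut-side-unique t sa sb j x∈ x′∈ y∈ y′∈
        , cut-side-unique t (Split-sym sa) (Split-sym sb) (Joins-sym j) y∈ y′∈ x∈ x′∈ )
... | inj₂ (refl , refl) = inj₂
        ( cut-side-unique t sa (Split-sym sb) j x∈ y′∈ y∈ x′∈
        , cut-side-unique t (Split-sym sa) sb (Joins-sym j) y∈ x′∈ x∈ y′∈ )

-- EPTs and their weight.

IsEPT-resp-≋ : ∀ {T} → G ≋ H → IsEPT G T → IsEPT H T
IsEPT-resp-≋ (vs , _) (leafEPT eq) =
  leafEPT (↭-singleton-inv (subst (_ ↭_) eq (↭-sym vs)))
IsEPT-resp-≋ (vs , es) (nodeEPT sp l r) = nodeEPT record
  { vertices = ↭-trans (↭-sym vs) (vertices sp)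
  ; edges    = ↭-trans (↭-sym es) (edges sp)
  ; tree₁    = tree₁ sp
  ; tree₂    = tree₂ sp
  } l r

leaves-EPT : ∀ {T} → IsEPT G T → leaves T ≡ ∣ G ∣
leaves-EPT (leafEPT eq)     = cong length (≡.sym eq)
leaves-EPT (nodeEPT sp l r) =
  ≡.trans (cong₂ _+_ (leaves-EPT l) (leaves-EPT r)) (≡.sym (∣∣-split sp))

BalancedCutEPT⇒IsEPT : ∀ {T} → BalancedCutEPT G T → IsEPT G T
BalancedCutEPT⇒IsEPT (leafBC eq)           = leafEPT eq
BalancedCutEPT⇒IsEPT (nodeBC (sp , _) l r) =
  nodeEPT sp (BalancedCutEPT⇒IsEPT l) (BalancedCutEPT⇒IsEPT r)

-- The min-term pays for later cuts of T: a balanced node of T may be useless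
-- after cutting e first, but then its restriction is unbalanced, hence lighter.
weight : BTree → ℕ
weight (leaf _)     = 0
weight (node _ l r) = weight l + weight r + (leaves l + leaves r + leaves l ⊓ leaves r)

weight-swap : ∀ e l r → weight (node e l r) ≡ weight (node e r l)
weight-swap e l r = cong₂ _+_ (+-comm (weight l) (weight r))
  (cong₂ _+_ (+-comm (leaves l) (leaves r)) (⊓-comm (leaves l) (leaves r)))

-- Restricting an EPT to the sides of a cut.

-- The restrictions T₁, T₂ of an EPT T of weight n to the two sides of a cut e.
record Restriction (c : ℕ) (A₁ A₂ : Graph) (n : ℕ) : Set where
  field
    {T₁ T₂} : BTree
    {saved} : ℕ
    ept₁    : IsEPT A₁ T₁
    ept₂    : IsEPT A₂ T₂
    saving  : Saving c ∣ A₁ ∣ ∣ A₂ ∣ saved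
    bound   : weight T₁ + weight T₂ + saved ≤ n
open Restriction

Restriction-sym : ∀ {c n} → Restriction c A₁ A₂ n → Restriction c A₂ A₁ n
Restriction-sym {n = n} R = record
  { ept₁ = ept₂ R ; ept₂ = ept₁ R ; saving = Saving-sym (saving R)
  ; bound = subst (λ m → m + saved R ≤ n) (+-comm (weight (T₁ R)) (weight (T₂ R))) (bound R) }

-- When the root of the EPT is `e`, its children are already the restrictions, and the whole weight
-- of the root is saved.
restrict-cut : ∀ {c l r} → A₁ ≋ B₁ → A₂ ≋ B₂ → IsEPT B₁ l → IsEPT B₂ r →
               Restriction c A₁ A₂ (weight (node e l r))
restrict-cut {A₁} {B₁} {A₂} {B₂} {c = c} {l} {r} (vs₁ , es₁) (vs₂ , es₂) p q = record
  { ept₁ = p′ ; ept₂ = q′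
  ; saving = subst₂ (λ a b → Saving c a b (leaves l + leaves r + leaves l ⊓ leaves r))
               (leaves-EPT p′) (leaves-EPT q′) cut
  ; bound = ≤-refl }
  where
  p′ : IsEPT A₁ l
  p′ = IsEPT-resp-≋ (↭-sym vs₁ , ↭-sym es₁) p
  q′ : IsEPT A₂ r
  q′ = IsEPT-resp-≋ (↭-sym vs₂ , ↭-sym es₂) q

restrict-same : ∀ {c l r} → IsTree G → Split G e A₁ A₂ → Split G e B₁ B₂ →
                IsEPT B₁ l → IsEPT B₂ r → Restriction c A₁ A₂ (weight (node e l r))
restrict-same {e = e} {l = l} {r} t sa sb pl pr with cut-unique t sa sb
... | inj₁ (p , q) = restrict-cut {e = e} p q pl pr
... | inj₂ (p , q) = subst (Restriction _ _ _) (weight-swap e r l) (restrict-cut {e = e} p q pr pl)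

-- The root `f` survives on the side `A₁`. Its subtree `r` is kept whole because `B₂` lies inside
-- `A₁`, while `l` is restricted to the middle piece and `A₂`. The recursive call enters as `rec`,
-- so that one argument serves all four positions of `e` and `f` in `restrict`.
restrict-node : ∀ {c l r} → IsTree G → SmallSide≤ c G → Split G e A₁ A₂ → Split G f B₁ B₂ →
                f ∈ E A₁ → e ∈ E B₁ → IsEPT B₁ l → IsEPT B₂ r →
                (∀ {K} → Split B₁ e K A₂ → Restriction c K A₂ (weight l)) →
                Restriction c A₁ A₂ (weight (node f l r))
restrict-node {A₁ = A₁} {A₂} {f} {B₁} {B₂} {c} {l} {r} t small se sf f∈ e∈ pl pr rec = record
  { T₁     = node f (T₁ R) r
  ; ept₁   = nodeEPT spᶠ (ept₁ R) pr
  ; ept₂   = ept₂ R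
  ; saving = subst (λ n → Saving c n b (s + b + q)) (≡.sym (∣∣-split spᶠ))
      (left (∣∣-positive (tree₁ spᶠ))
        (subst (_≤ c) (≡.trans (cong (_⊓ p) (∣∣-split spᵉ)) (⊓-comm (a + b) p)) (small f B₁ B₂ sf))
        (saving R)
        (≤-reflexive (≡.trans (cong (s + b +_) (≡.sym q+m)) (≡.sym (+-assoc (s + b) q (p ⊓ a))))))
  ; bound  = begin
      w₁ + weight r + (leaves (T₁ R) + leaves r + leaves (T₁ R) ⊓ leaves r) + w₂ + (s + b + q)
        ≡⟨ cong₂ (λ i j → w₁ + weight r + (i + j + i ⊓ j) + w₂ + (s + b + q))
             (leaves-EPT (ept₁ R)) (leaves-EPT pr) ⟩
      w₁ + weight r + (a + p + a ⊓ p) + w₂ + (s + b + q)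
        ≡⟨ cong (λ m → w₁ + weight r + (a + p + m) + w₂ + (s + b + q)) (⊓-comm a p) ⟩
      w₁ + weight r + (a + p + p ⊓ a) + w₂ + (s + b + q)
        ≡⟨ shuffle w₁ (weight r) w₂ s a b p (p ⊓ a) q ⟩
      w₁ + w₂ + s + weight r + (a + b + p + (q + p ⊓ a))
        ≤⟨ +-monoˡ-≤ _ (+-monoˡ-≤ (weight r) (bound R)) ⟩
      weight l + weight r + (a + b + p + (q + p ⊓ a))
        ≡⟨ cong (λ m → weight l + weight r + (a + b + p + m)) (≡.trans q+m (⊓-comm p (a + b))) ⟩
      weight l + weight r + (a + b + p + (a + b) ⊓ p)
        ≡⟨ cong₂ (λ i j → weight l + weight r + (i + j + i ⊓ j))
             (≡.trans (leaves-EPT pl) (∣∣-split spᵉ)) (leaves-EPT pr) ⟨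
      weight l + weight r + (leaves l + leaves r + leaves l ⊓ leaves r) ∎
  }
  where
  open ≤-Reasoning
  spᵉ = middle-splitᵉ t se sf f∈ e∈
  spᶠ = middle-splitᶠ t se sf f∈ e∈
  R = rec spᵉ
  a = ∣ middle t se sf f∈ e∈ ∣
  b = ∣ A₂ ∣
  p = ∣ B₂ ∣
  s = saved R
  w₁ = weight (T₁ R)
  w₂ = weight (T₂ R)
  -- The drop of the min-term at the root `f`; the truncated difference is exact, as `q+m` shows.
  q = p ⊓ (a + b) ∸ p ⊓ a
  q+m : q + p ⊓ a ≡ p ⊓ (a + b)
  q+m = m∸n+n≡m (⊓-monoʳ-≤ p (m≤m+n a b))
  shuffle : ∀ w₁ wr w₂ s a b p m q →
            w₁ + wr + (a + p + m) + w₂ + (s + b + q) ≡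
            w₁ + w₂ + s + wr + (a + b + p + (q + m))
  shuffle = solve-∀

-- Descends in `T` towards the node of `e`. Exchanging the sides of either cut reduces every case
-- with distinct edges to `f` in `A₁` and `e` in `B₁`.
restrict : ∀ {c T} → IsTree G → SmallSide≤ c G → Split G e A₁ A₂ → IsEPT G T →
           Restriction c A₁ A₂ (weight T)
-- A single vertex has no cut, because both sides would be nonempty.
restrict t small se (leafEPT eq) = ⊥-elim (<-irrefl refl
  (≤-trans (+-mono-≤ (∣∣-positive (tree₁ se)) (∣∣-positive (tree₂ se)))
    (≤-reflexive (≡.trans (≡.sym (∣∣-split se)) (cong length eq)))))
restrict t small se (nodeEPT {e = f} {l} {r} sf pl pr)
  with E-cases se (cut∈ sf) | E-cases sf (cut∈ se)
... | inj₁ refl | _         = restrict-same t se sf pl pr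
... | inj₂ _    | inj₁ refl = restrict-same t se sf pl pr
... | inj₂ (inj₁ f∈) | inj₂ (inj₁ e∈) =
  restrict-node t small se sf f∈ e∈ pl pr
    (λ sp → restrict (tree₁ sf) (SmallSide≤-side t small sf) sp pl)
... | inj₂ (inj₂ f∈) | inj₂ (inj₁ e∈) =
  Restriction-sym (restrict-node t small (Split-sym se) sf f∈ e∈ pl pr
    (λ sp → restrict (tree₁ sf) (SmallSide≤-side t small sf) sp pl))
... | inj₂ (inj₁ f∈) | inj₂ (inj₂ e∈) =
  subst (Restriction _ _ _) (weight-swap f r l)
    (restrict-node t small se (Split-sym sf) f∈ e∈ pr pl
      (λ sp → restrict (tree₂ sf) (SmallSide≤-side t small (Split-sym sf)) sp pr))
... | inj₂ (inj₂ f∈) | inj₂ (inj₂ e∈) =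
  subst (Restriction _ _ _) (weight-swap f r l)
    (Restriction-sym (restrict-node t small (Split-sym se) (Split-sym sf) f∈ e∈ pr pl
      (λ sp → restrict (tree₂ sf) (SmallSide≤-side t small (Split-sym sf)) sp pr)))

-- Balanced cuts and the final estimate.

Balanced⇒SmallSide≤ : Balanced G e A₁ A₂ → SmallSide≤ (∣ A₁ ∣ ⊓ ∣ A₂ ∣) G
Balanced⇒SmallSide≤ (se , least) f F₁ F₂ sf =
  ⊓-⊔-exchange (≡.trans (≡.sym (∣∣-split se)) (∣∣-split sf)) (least f F₁ F₂ sf)

-- Induction on the balanced cut EPT with `T` arbitrary, since the induction hypotheses are applied
-- to the restrictions of `T`. Balance supplies `c` as the smaller side of the cut, the value that
-- `Saving-total` requires.
EPTsum≤weight : ∀ {T′ T} → IsTree G → BalancedCutEPT G T′ → IsEPT G T → EPTsum T′ ≤ weight T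
EPTsum≤weight t (leafBC _) _ = z≤n
EPTsum≤weight {T = T} t (nodeBC {l = l} {r} {A₁} {A₂} bal bl br) p = begin
  EPTsum l + leaves l + (EPTsum r + leaves r)
    ≡⟨ shuffle (EPTsum l) (leaves l) (EPTsum r) (leaves r) ⟩
  EPTsum l + EPTsum r + (leaves l + leaves r)
    ≡⟨ cong₂ (λ a b → EPTsum l + EPTsum r + (a + b)) (leaves-BC bl) (leaves-BC br) ⟩
  EPTsum l + EPTsum r + (∣ A₁ ∣ + ∣ A₂ ∣)
    ≤⟨ +-mono-≤ (+-mono-≤ (EPTsum≤weight (tree₁ se) bl (ept₁ R))
                          (EPTsum≤weight (tree₂ se) br (ept₂ R)))
                (Saving-total (saving R)) ⟩
  weight (T₁ R) + weight (T₂ R) + saved R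
    ≤⟨ bound R ⟩
  weight T ∎
  where
  open ≤-Reasoning
  se = proj₁ bal
  R = restrict t (Balanced⇒SmallSide≤ bal) se p
  leaves-BC : ∀ {G T} → BalancedCutEPT G T → leaves T ≡ ∣ G ∣
  leaves-BC = leaves-EPT ∘ BalancedCutEPT⇒IsEPT
  shuffle : ∀ a b c d → a + b + (c + d) ≡ a + c + (b + d)
  shuffle = solve-∀

double-weight≤ : ∀ T → 2 * weight T ≤ 3 * EPTsum T
double-weight≤ (leaf _)     = z≤n
double-weight≤ (node _ l r) = begin
  2 * (weight l + weight r + (a + b + a ⊓ b))
    ≡⟨ expand (weight l) (weight r) a b (a ⊓ b) ⟩
  2 * weight l + 2 * weight r + (2 * (a + b) + (a ⊓ b + a ⊓ b))
    ≤⟨ +-mono-≤ (+-mono-≤ (double-weight≤ l) (double-weight≤ r))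
         (+-monoʳ-≤ (2 * (a + b)) (+-mono-≤ (m⊓n≤m a b) (m⊓n≤n a b))) ⟩
  3 * EPTsum l + 3 * EPTsum r + (2 * (a + b) + (a + b))
    ≡⟨ collect (EPTsum l) (EPTsum r) a b ⟩
  3 * (EPTsum l + a + (EPTsum r + b)) ∎
  where
  open ≤-Reasoning
  a = leaves l
  b = leaves r
  expand : ∀ x y a b m → 2 * (x + y + (a + b + m)) ≡ 2 * x + 2 * y + (2 * (a + b) + (m + m))
  expand = solve-∀
  collect : ∀ x y a b → 3 * x + 3 * y + (2 * (a + b) + (a + b)) ≡ 3 * (x + a + (y + b))
  collect = solve-∀

-- Comparison with every EPT `T` includes an optimal one; the factors 2 and 3 clear the fraction.
theorem2 : (G : Graph) → IsTree G →
    (T′ : BTree) → BalancedCutEPT G T′ →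
    (T : BTree) → IsEPT G T →
    2 * EPTsum T′ ≤ 3 * EPTsum T
theorem2 G t T′ bc T p = ≤-trans (*-monoʳ-≤ 2 (EPTsum≤weight t bc p)) (double-weight≤ T)
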